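{- Let $q$ be a prime power, let $t\ge 2$, $k_1\ge 2$ and $k_2\ge 0$ be integers. If there exists a $(k_1,k_2)$-harc in $\Pi_{t-1}(q)$, then there exists an ideal secret sharing scheme of hierarchical model with $k_1+k_2-1$ participants and of strength $t$.
   Context: Projective geometry. $\Pi_r(q)$ is the projective space of dimension $r$ over $GF(q)$. Points are (linearly) independent if vectors representing them are linearly independent. A $k$-arc in $\Pi_r(q)$ is a set of $k$ points any $r+1$ of which are independent. Let $\Psi$ be a hyperplane of $\Pi_r(q)$, $\mathcal{K}_1$ a set of $k_1$ points in $\Pi_r(q)\setminus\Psi$ and $\mathcal{K}_2$ a set of $k_2$ points in $\Psi$. The set $\mathcal{K}=\mathcal{K}_1\cup\mathcal{K}_2$ is a $(k_1,k_2)$-harc (hierarchical arc) in $\Pi_r(q)$ if: (a) $\mathcal{K}_1$ is a $k_1$-arc in $\Pi_r(q)$; (b) $\mathcal{K}_2$ is a $k_2$-arc in the $(r-1)$-dimensional projective space $\Psi$; (c) any $r+1$ points of $\mathcal{K}$ not contained in $\Psi$ are independent. Secret sharing. Given finite sets $\mathcal{K}_0$ (keys), $\mathcal{S}$ (shares), $\mathcal{P}$ (participants) and a dealer $D\notin\mathcal{P}$, an access structure $\Gamma$ is a monotone (upward closed) family of subsets of $\mathcal{P}$; it is determined by its basis $\Gamma^*$, the set of its minimal members. A perfect secret sharing scheme realizing $\Gamma$ is represented by an array $M$ with rows indexed by a finite nonempty set $\mathcal{F}$ and columns indexed by $\{D\}\cup\mathcal{P}$, entries $M(f,D)\in\mathcal{K}_0$,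 $M(f,P)\in\mathcal{S}$, and $M(f,B)=(M(f,P):P\in B)$, such that: (1) if $B\in\Gamma$ and $M(f,B)=M(f',B)$ then $M(f,D)=M(f',D)$; (2) for any $B\subseteq\mathcal{P}$ with $B\notin\Gamma$ and any $f\in\mathcal{F}$, the number $|\{g\in\mathcal{F}:M(g,D)=K,\ M(g,B)=M(f,B)\}|$ is the same for every $K\in\mathcal{K}_0$. It is ideal if the information rate $\log_2|\mathcal{K}_0|/\log_2|\mathcal{S}|$ equals $1$ (so $|\mathcal{K}_0|=|\mathcal{S}|\ge2$). Hierarchical model of strength $t$: $\mathcal{P}=\mathcal{U}\cup\mathcal{L}$ is composed of two disjoint groups, the upper group $\mathcal{U}$ and the lower group $\mathcal{L}$, and $\Gamma^*=\binom{\mathcal{U}\cup\mathcal{L}}{t}\setminus\binom{\mathcal{L}}{t}$, i.e. the minimal authorized subsets are exactly the $t$-subsets of $\mathcal{P}$ containing at least one member of $\mathcal{U}$. A scheme of hierarchical model of strength $t$ is a scheme realizing such an access structure. -}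

module Defs where

open import Algebra.Bundles using (CommutativeRing)
import Algebra.Properties.Monoid.Sum as MonoidSum
open import Data.Fin using (Fin)
import Data.Fin as Fin
open import Data.Fin.Properties using (all?)
open import Data.Fin.Subset using (Subset; _∈_; _⊆_; _∪_; _∩_; ⊤; ⊥; ∣_∣; Nonempty)
open import Data.Fin.Subset.Properties using (_∈?_)
import Data.Nat as ℕ
open import Data.Nat using (ℕ; suc; _≤_; _^_; NonZero)
open import Data.Nat.Primality using (Prime)
open import Data.Product using (Σ-syntax; ∃-syntax; _×_)
open import Data.Vec using (count; allFin)
open import Data.Vec.Functional using (Vector; _++_)
open import Function using (_∘_; _⇔_)
open import Function.Bundles using (Inverse)
open import Function.Definitions using (Injective)
open import Level using (Level; _⊔_) renaming (suc to lsuc)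
open import Relation.Binary.PropositionalEquality using (_≡_)
import Relation.Binary.PropositionalEquality as ≡
open import Relation.Nullary using (¬_; Dec; _×-dec_; _→-dec_)
open import Relation.Unary using (Pred; Decidable)

PrimePower : ℕ → Set
PrimePower q = ∃[ p ] ∃[ m ] (Prime p × 1 ≤ m × q ≡ p ^ m)

-- A field with exactly q elements. As such a field is unique up to
-- isomorphism, results about GF(q) are stated for an arbitrary one.
record GaloisField (q : ℕ) (c ℓ : Level) : Set (lsuc (c ⊔ ℓ)) where
  field
    commutativeRing : CommutativeRing c ℓ
  open CommutativeRing commutativeRing public
  field
    1≉0     : ¬ (1# ≈ 0#)
    inverse : ∀ x → ¬ (x ≈ 0#) → ∃[ y ] (x * y ≈ 1#)
    order   : Inverse setoid (≡.setoid (Fin q))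

module Projective {q : ℕ} {c ℓ : Level} (𝔽 : GaloisField q c ℓ) where
  open GaloisField 𝔽
  open MonoidSum +-monoid using (sum)

  -- A point of Π_r(q), given by homogeneous coordinates.
  record Point (r : ℕ) : Set (c ⊔ ℓ) where
    field
      vec     : Vector Carrier (suc r)
      nonzero : ¬ (∀ j → vec j ≈ 0#)
  open Point public

  -- Equality of points: proportional coordinate vectors.
  _∼_ : ∀ {r} → Point r → Point r → Set (c ⊔ ℓ)
  x ∼ y = ∃[ a ] (¬ (a ≈ 0#) × ∀ j → vec x j ≈ a * vec y j)

  combination : ∀ {r m} → Vector Carrier m → (Fin m → Point r) → Vector Carrier (suc r)
  combination a x j = sum (λ i → a i * vec (x i) j)

  Independent : ∀ {r m} → (Fin m → Point r) → Set (c ⊔ ℓ)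
  Independent x = ∀ a → (∀ j → combination a x j ≈ 0#) → ∀ i → a i ≈ 0#

  -- A projective subspace of dimension m - 1, spanned by m independent points.
  record Subspace (r m : ℕ) : Set (c ⊔ ℓ) where
    field
      basis       : Fin m → Point r
      independent : Independent basis

  _∈ˢ_ : ∀ {r m} → Point r → Subspace r m → Set (c ⊔ ℓ)
  x ∈ˢ Ψ = ∃[ a ] (∀ j → vec x j ≈ combination a (Subspace.basis Ψ) j)

  -- Projective dimension r - 1.
  Hyperplane : ℕ → Set (c ⊔ ℓ)
  Hyperplane r = Subspace r r

  -- The family lists a set of exactly k points.
  Distinct : ∀ {r k} → (Fin k → Point r) → Set (c ⊔ ℓ)
  Distinct K = Injective _≡_ _∼_ K

  AnyIndependent : ∀ {r k} → ℕ → (Fin k → Point r) → Set (c ⊔ ℓ)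
  AnyIndependent {k = k} m K =
    ∀ (e : Fin m → Fin k) → Injective _≡_ _≡_ e → Independent (K ∘ e)

  IsArc : ∀ {r k} → (Fin k → Point r) → Set (c ⊔ ℓ)
  IsArc {r} K = Distinct K × AnyIndependent (suc r) K

  -- An arc in a subspace of projective dimension m - 1: any m of its points
  -- are independent.
  IsArcIn : ∀ {r m k} → Subspace r m → (Fin k → Point r) → Set (c ⊔ ℓ)
  IsArcIn {m = m} Ψ K = (∀ i → K i ∈ˢ Ψ) × Distinct K × AnyIndependent m K

  record Harc (r k₁ k₂ : ℕ) : Set (c ⊔ ℓ) where
    field
      Ψ          : Hyperplane r
      K₁         : Fin k₁ → Point r
      K₂         : Fin k₂ → Point r
      K₁-outside : ∀ i → ¬ (K₁ i ∈ˢ Ψ)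
      K₁-arc     : IsArc K₁
      K₂-arc     : IsArcIn Ψ K₂
      mixed      : ∀ (e : Fin (suc r) → Fin (k₁ ℕ.+ k₂)) → Injective _≡_ _≡_ e →
                   ¬ (∀ i → (K₁ ++ K₂) (e i) ∈ˢ Ψ) → Independent ((K₁ ++ K₂) ∘ e)

open Projective public using (Harc)

-- The participants are the elements of Fin n. A family of subsets of a finite
-- set is classically decidable, so decidability is part of the data.
record AccessStructure (n : ℕ) : Set₁ where
  field
    Authorized  : Pred (Subset n) Level.zero
    authorized? : Decidable Authorized
    monotone    : ∀ {B C} → B ⊆ C → Authorized B → Authorized C

  -- Membership in the basis Γ*.
  Minimal : Pred (Subset n) Level.zero
  Minimal B = Authorized B × (∀ C → Authorized C → C ⊆ B → C ≡ B)

-- The array M, with the column of the dealer (key) kept apart from the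
-- columns of the participants (share) as their entries lie in different sets.
record PerfectScheme {n : ℕ} (Γ : AccessStructure n) : Set where
  open AccessStructure Γ
  field
    #keys #shares #rows : ℕ
    rows-nonempty : NonZero #rows
    key   : Fin #rows → Fin #keys
    share : Fin #rows → Fin n → Fin #shares

  -- M(f,B) = M(g,B)
  AgreeOn : Subset n → Fin #rows → Fin #rows → Set
  AgreeOn B f g = ∀ P → P ∈ B → share f P ≡ share g P

  agreeOn? : ∀ B f g → Dec (AgreeOn B f g)
  agreeOn? B f g = all? (λ P → (P ∈? B) →-dec (share f P Fin.≟ share g P))

  -- |{ g : M(g,D) = K, M(g,B) = M(f,B) }|
  #consistent : Subset n → Fin #rows → Fin #keys → ℕ
  #consistent B f K =
    count (λ g → (key g Fin.≟ K) ×-dec agreeOn? B g f) (allFin #rows)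

  field
    correct : ∀ B → Authorized B → ∀ f g → AgreeOn B f g → key f ≡ key g
    perfect : ∀ B → ¬ Authorized B → ∀ f K K′ →
              #consistent B f K ≡ #consistent B f K′

-- Information rate log₂ #keys / log₂ #shares equal to 1; the bound 2 ≤ #shares
-- is what makes the quotient meaningful.
IsIdeal : ∀ {n} {Γ : AccessStructure n} → PerfectScheme Γ → Set
IsIdeal S = #keys ≡ #shares × 2 ≤ #shares
  where open PerfectScheme S

-- B belongs to the family of all t-subsets of X.
_∈-choose⟨_,_⟩ : ∀ {n} → Subset n → Subset n → ℕ → Set
B ∈-choose⟨ X , t ⟩ = B ⊆ X × ∣ B ∣ ≡ t

-- The upper group is required to be nonempty: otherwise Γ* is empty and the
-- scheme has no authorized set at all. The lower group may be empty.
record IsHierarchical {n : ℕ} (t : ℕ) (Γ : AccessStructure n) : Set where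
  field
    U L            : Subset n
    covering       : U ∪ L ≡ ⊤
    disjoint       : U ∩ L ≡ ⊥
    upper-nonempty : Nonempty U
    basis          : ∀ B → AccessStructure.Minimal Γ B ⇔
                     (B ∈-choose⟨ U ∪ L , t ⟩ × ¬ (B ∈-choose⟨ L , t ⟩))

IdealHierarchicalScheme : (n t : ℕ) → Set₁
IdealHierarchicalScheme n t =
  Σ[ Γ ∈ AccessStructure n ] IsHierarchical t Γ × Σ[ S ∈ PerfectScheme Γ ] IsIdeal S

{-# OPTIONS --safe #-}
module Submission where

open import Defs
open import Data.Nat using (ℕ; _+_; _∸_; _≤_)
import Algebra.Properties.CommutativeMonoid.Sum as CommutativeMonoidSum
import Algebra.Properties.Ring as RingProperties
import Algebra.Properties.Semiring.Sum as SemiringSum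
open import Data.Bool using (if_then_else_)
import Data.Fin as Fin
open import Data.Fin using (Fin; zero; suc; splitAt; finToFun; funToFin)
open import Data.Fin.Permutation using (Permutation′; permutation; _⟨$⟩ʳ_)
open import Data.Fin.Properties
  using (any?; injective⇒≤; suc-injective; funToFin-finToFin; finToFun-funToFin)
open import Data.Fin.Subset
  using (Subset; Nonempty; inside; outside; _∈_; _⊆_; _∪_; _∩_; ⊤; ∁; ⁅_⁆; ∣_∣)
open import Data.Fin.Subset.Properties
open import Data.Nat using (zero; suc; _^_; z≤n; s≤s; s≤s⁻¹; >-nonZero; _≤?_)
import Data.Nat.Properties as ℕₚ
open import Data.Product using (Σ-syntax; ∃-syntax; _×_; _,_; proj₁; proj₂)
open import Data.Sum using (inj₁; inj₂; [_,_])
open import Data.Vec using ([]; _∷_; count; allFin; tabulate; here; there)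
open import Data.Vec.Functional using (Vector; replicate) renaming (_∷_ to _∷ᶠ_; _++_ to _++ᶠ_)
open import Data.Vec.Properties using ([]=⇒lookup; lookup⇒[]=; lookup∘tabulate)
open import Function using (_∘_; _⇔_; mk⇔; const)
open import Function.Bundles using (Inverse)
open import Function.Definitions using (Injective)
open import Level using (Level)
import Relation.Binary.PropositionalEquality as ≡
open ≡ using (_≡_; refl)
import Relation.Binary.Reasoning.Setoid as SetoidReasoning
open import Relation.Nullary using (¬_; Dec; yes; no; does; contradiction; _×-dec_)
open import Relation.Nullary.Decidable using (does-⇔; map′)
open import Relation.Unary using (Pred; Decidable)

-- Write t = r + 1. One point d of K₁ is given to the dealer, the remaining
-- points of K₁ to the upper group and the points of K₂ to the lower group. The
-- rows of the array are the linear functionals f on GF(q)^t; the key is the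
-- value of f at d and the share of a participant is the value of f at the point
-- of that participant.
--
-- If B is authorized, it contains t participants, one of them upper. Their
-- points are not all in Ψ, so they are independent and a functional is
-- determined by its values on them (annihilates-all): the shares of B determine
-- the key.
--
-- If B is not authorized, there is a functional w with value 1 at d and 0 at
-- all points of B. When B lies in the lower group, such a w exists because its
-- points lie in Ψ, and d together with a basis of Ψ is independent
-- (hyperplane-and-point). When B has at most r members, it is enlarged to
-- exactly r participants; their points together with d are t points that are
-- not all in Ψ, hence independent, and again w exists
-- (interpolating-functional). Adding multiples of w to functionals fixes all
-- shares of B and permutes the rows, carrying the rows with key K to the rows
-- with key K′, so all keys are equally frequent (consistent-translation).
--
-- With fewer than r participants the enlargement is impossible: the harc has no
-- r + 1 distinct points, so its axioms on such families are vacuous and its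
-- points may be dependent. In that case no set is authorized, and a scheme whose
-- shares are all zero suffices (idealScheme).
--
-- The linear algebra uses no elimination. The field is finite, so an injective
-- linear endomorphism of GF(q)^t is surjective by counting: independent rows of
-- a square matrix span (independent⇒spanning). Spanning rows have an
-- independent transpose (independentᵀ), which then spans as well, and this is
-- the existence of functionals with prescribed values.

private
  variable
    m n : ℕ

-- Finite sets and counting

injective⇒surjective : (f : Fin n → Fin n) → Injective _≡_ _≡_ f → ∀ y → ∃[ x ] f x ≡ y
injective⇒surjective {n} f f-inj y with any? (λ x → f x Fin.≟ y)
... | yes hit = hit
... | no miss = contradiction (injective⇒≤ {f = y ∷ᶠ f} inj) ℕₚ.1+n≰n
  where
  inj : Injective _≡_ _≡_ (y ∷ᶠ f)
  inj {zero}  {zero}  _  = refl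
  inj {zero}  {suc j} eq = contradiction (j , ≡.sym eq) miss
  inj {suc i} {zero}  eq = contradiction (i , eq) miss
  inj {suc i} {suc j} eq = ≡.cong suc (f-inj eq)

-- Two predicates that correspond under a permutation hold equally often.
count-permute : ∀ {p} {P Q : Pred (Fin n) p} (P? : Decidable P) (Q? : Decidable Q)
                (π : Permutation′ n) → (∀ i → P i ⇔ Q (π ⟨$⟩ʳ i)) →
                count P? (allFin n) ≡ count Q? (allFin n)
count-permute {n} P? Q? π P⇔Qπ = begin
  count P? (allFin n)                  ≡⟨ count-tabulate P? (λ i → i) ⟩
  sum (indicator P?)                   ≡⟨ sum-cong-≗ (λ i → ≡.cong (if_then 1 else 0)
                                            (does-⇔ (P⇔Qπ i) (P? i) (Q? (π ⟨$⟩ʳ i)))) ⟩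
  sum (indicator Q? ∘ (π ⟨$⟩ʳ_))       ≡⟨ sum-permute (indicator Q?) π ⟨
  sum (indicator Q?)                   ≡⟨ count-tabulate Q? (λ i → i) ⟨
  count Q? (allFin n)                  ∎
  where
  open ≡.≡-Reasoning
  open CommutativeMonoidSum ℕₚ.+-0-commutativeMonoid using (sum; sum-cong-≗; sum-permute)

  indicator : ∀ {a p} {A : Set a} {R : Pred A p} → Decidable R → A → ℕ
  indicator R? x = if does (R? x) then 1 else 0

  count-tabulate : ∀ {a p} {A : Set a} {R : Pred A p} (R? : Decidable R) {k} (f : Fin k → A) →
                   count R? (tabulate f) ≡ sum (indicator R? ∘ f)
  count-tabulate R? {zero}  f = refl
  count-tabulate R? {suc k} f with R? (f zero)
  ... | yes _ = ≡.cong suc (count-tabulate R? (f ∘ suc))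
  ... | no  _ = count-tabulate R? (f ∘ suc)

subset-between : ∀ {B C : Subset n} {m} → B ⊆ C → ∣ B ∣ ≤ m → m ≤ ∣ C ∣ →
                 ∃[ S ] (B ⊆ S × S ⊆ C × ∣ S ∣ ≡ m)
subset-between {B = []} {[]} {zero} B⊆C _ _ = [] , B⊆C , B⊆C , refl
subset-between {B = outside ∷ B} {outside ∷ C} B⊆C b c
  with S , B⊆S , S⊆C , eq ← subset-between (drop-∷-⊆ B⊆C) b c
  = outside ∷ S , s⊆s B⊆S , s⊆s S⊆C , eq
subset-between {B = inside ∷ B} {outside ∷ C} B⊆C b c = contradiction (B⊆C here) λ ()
subset-between {B = inside ∷ B} {inside ∷ C} {suc m} B⊆C b c
  with S , B⊆S , S⊆C , eq ← subset-between (drop-∷-⊆ B⊆C) (s≤s⁻¹ b) (s≤s⁻¹ c)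
  = inside ∷ S , s⊆s B⊆S , s⊆s S⊆C , ≡.cong suc eq
subset-between {B = outside ∷ B} {inside ∷ C} {m} B⊆C b c with m ≤? ∣ C ∣
... | yes m≤∣C∣
  with S , B⊆S , S⊆C , eq ← subset-between (drop-∷-⊆ B⊆C) b m≤∣C∣
  = outside ∷ S , s⊆s B⊆S , out⊆ S⊆C , eq
-- Here m is one more than the size of C, so the whole upper bound is the answer.
... | no m≰∣C∣ = inside ∷ C , B⊆C , (λ z → z) , ℕₚ.≤-antisym (ℕₚ.≰⇒> m≰∣C∣) c

-- A listing, without repetition, of the subset S as the image of Fin m.
record Enumeration (S : Subset n) (m : ℕ) : Set where
  field
    element   : Fin m → Fin n
    injective : Injective _≡_ _≡_ element
    sound     : ∀ i → element i ∈ S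
    complete  : ∀ {x} → x ∈ S → ∃[ i ] element i ≡ x

enumerate : (S : Subset n) → Enumeration S ∣ S ∣
enumerate [] = record
  { element = λ () ; injective = λ { {()} } ; sound = λ () ; complete = λ () }
enumerate (outside ∷ S) = record
  { element   = suc ∘ element
  ; injective = injective ∘ suc-injective
  ; sound     = there ∘ sound
  ; complete  = λ { (there x∈S) → let i , eq = complete x∈S in i , ≡.cong suc eq }
  }
  where open Enumeration (enumerate S)
enumerate (inside ∷ S) = record
  { element   = zero ∷ᶠ (suc ∘ element)
  ; injective = λ { {zero} {zero} _ → refl
                  ; {suc i} {suc j} eq → ≡.cong suc (injective (suc-injective eq)) }
  ; sound     = λ { zero → here ; (suc i) → there (sound i) }
  ; complete  = λ { here → zero , refl
                  ; (there x∈S) → let i , eq = complete x∈S in suc i , ≡.cong suc eq }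
  }
  where open Enumeration (enumerate S)

enumerateAs : ∀ (S : Subset n) → ∣ S ∣ ≡ m → Enumeration S m
enumerateAs S refl = enumerate S

-- The hierarchical access structure

-- The structure of strength t with upper group U and lower group the complement
-- of U: a set is authorized if it has at least t members, one of them in U.
hierarchical : ℕ → Subset n → AccessStructure n
hierarchical t U = record
  { Authorized  = λ B → t ≤ ∣ B ∣ × Nonempty (B ∩ U)
  ; authorized? = λ B → (t ≤? ∣ B ∣) ×-dec nonempty? (B ∩ U)
  ; monotone    = λ { {B} {C} B⊆C (t≤∣B∣ , u , u∈) →
      let u∈B , u∈U = x∈p∩q⁻ B U u∈ in
      ℕₚ.≤-trans t≤∣B∣ (p⊆q⇒∣p∣≤∣q∣ B⊆C) , u , x∈p∩q⁺ (B⊆C u∈B , u∈U) }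
  }

⁅⁆⊆ : ∀ {x : Fin n} {B} → x ∈ B → ⁅ x ⁆ ⊆ B
⁅⁆⊆ x∈B y∈ rewrite x∈⁅y⁆⇒x≡y _ y∈ = x∈B

-- An authorized set contains an authorized set of exactly t members.
authorized⊇basic : ∀ {B : Subset n} {u} t → 1 ≤ t → t ≤ ∣ B ∣ → u ∈ B →
                   ∃[ S ] (u ∈ S × S ⊆ B × ∣ S ∣ ≡ t)
authorized⊇basic {u = u} t 1≤t t≤∣B∣ u∈B
  with S , u⊆S , S⊆B , eq ←
    subset-between (⁅⁆⊆ u∈B) (ℕₚ.≤-trans (ℕₚ.≤-reflexive (∣⁅x⁆∣≡1 u)) 1≤t) t≤∣B∣
  = S , u⊆S (x∈⁅x⁆ u) , S⊆B , eq

disjoint⇒⊆∁ : ∀ {B U : Subset n} → ¬ Nonempty (B ∩ U) → B ⊆ ∁ U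
disjoint⇒⊆∁ none x∈B = x∉p⇒x∈∁p λ x∈U → none (_ , x∈p∩q⁺ (x∈B , x∈U))

⊆∧∣∣≥⇒≡ : ∀ {C B : Subset n} → C ⊆ B → ∣ B ∣ ≤ ∣ C ∣ → C ≡ B
⊆∧∣∣≥⇒≡ {C = C} {B} C⊆B ∣B∣≤∣C∣ = ⊆-antisym C⊆B λ {x} x∈B → helper x∈B (x ∈? C)
  where
  helper : ∀ {x} → x ∈ B → Dec (x ∈ C) → x ∈ C
  helper x∈B (yes x∈C) = x∈C
  helper x∈B (no  x∉C) =
    contradiction ∣B∣≤∣C∣ (ℕₚ.<⇒≱ (p⊂q⇒∣p∣<∣q∣ (C⊆B , _ , x∈B , x∉C)))

isHierarchical : ∀ t (U : Subset n) → 1 ≤ t → Nonempty U → IsHierarchical t (hierarchical t U)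
isHierarchical {n} t U 1≤t U≢∅ = record
  { U = U ; L = ∁ U
  ; covering = p∪∁p≡⊤ U ; disjoint = ∩-inverseʳ U
  ; upper-nonempty = U≢∅
  ; basis = λ B → mk⇔ (minimal⇒basic B) (basic⇒minimal B)
  }
  where
  open AccessStructure (hierarchical t U)

  minimal⇒basic : ∀ B → Minimal B →
                  B ∈-choose⟨ U ∪ ∁ U , t ⟩ × ¬ (B ∈-choose⟨ ∁ U , t ⟩)
  minimal⇒basic B ((t≤∣B∣ , u , u∈) , least)
    with u∈B , u∈U ← x∈p∩q⁻ B U u∈
    with S , u∈S , S⊆B , ∣S∣≡t ← authorized⊇basic t 1≤t t≤∣B∣ u∈B
    with refl ← least S (ℕₚ.≤-reflexive (≡.sym ∣S∣≡t) , u , x∈p∩q⁺ (u∈S , u∈U)) S⊆B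
    = (≡.subst (B ⊆_) (≡.sym (p∪∁p≡⊤ U)) (⊆-max B) , ∣S∣≡t)
    , λ (B⊆∁U , _) → x∈∁p⇒x∉p (B⊆∁U u∈B) u∈U

  basic⇒minimal : ∀ B → B ∈-choose⟨ U ∪ ∁ U , t ⟩ × ¬ (B ∈-choose⟨ ∁ U , t ⟩) →
                  Minimal B
  basic⇒minimal B ((_ , refl) , B⊈∁U) with nonempty? (B ∩ U)
  ... | yes B∩U≢∅ = (ℕₚ.≤-refl , B∩U≢∅) , λ C (∣B∣≤∣C∣ , _) C⊆B → ⊆∧∣∣≥⇒≡ C⊆B ∣B∣≤∣C∣
  ... | no  B∩U≡∅ = contradiction ((λ {_} → disjoint⇒⊆∁ B∩U≡∅) , refl) B⊈∁U

-- Linear algebra over a finite field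

module _ {q : ℕ} {c ℓ : Level} (𝔽 : GaloisField q c ℓ) where
  open GaloisField 𝔽
    renaming (_+_ to _⊕_; -_ to ⊖_; refl to ≈-refl; sym to ≈-sym; trans to ≈-trans)
    hiding (zero)
  open SemiringSum semiring
  open RingProperties ring
    using (-1*x≈-x; -‿distribˡ-*; -‿distribʳ-*; xyx⁻¹≈y; +-inverseˡ-unique; x∙y⁻¹≈ε⇒x≈y; x≈y⇒x∙y⁻¹≈ε)
  open SetoidReasoning setoid
  module 𝕗 = Inverse order

  to-injective : ∀ {x y} → 𝕗.to x ≡ 𝕗.to y → x ≈ y
  to-injective {x} eq = ≈-trans (≈-sym (𝕗.strictlyInverseʳ x)) (𝕗.inverseʳ eq)

  _≈?_ : ∀ x y → Dec (x ≈ y)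
  x ≈? y = map′ to-injective 𝕗.to-cong (𝕗.to x Fin.≟ 𝕗.to y)

  2≤q : 2 ≤ q
  2≤q = injective⇒≤ {f = 𝕗.to ∘ bit} λ
    { {zero} {zero} _ → refl
    ; {zero} {suc zero} eq → contradiction (to-injective (≡.sym eq)) 1≉0
    ; {suc zero} {zero} eq → contradiction (to-injective eq) 1≉0
    ; {suc zero} {suc zero} _ → refl }
    where
    bit : Vector Carrier 2
    bit = 0# ∷ᶠ replicate 1 1#

  -- Differences are written with the scalar -1 to match u +[ k ] v.
  x-y≈0⇒x≈y : ∀ {x y} → x ⊕ ⊖ 1# * y ≈ 0# → x ≈ y
  x-y≈0⇒x≈y {x} {y} eq = x∙y⁻¹≈ε⇒x≈y x y (≈-trans (+-congˡ (≈-sym (-1*x≈-x y))) eq)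

  x≈y⇒x-y≈0 : ∀ {x y} → x ≈ y → x ⊕ ⊖ 1# * y ≈ 0#
  x≈y⇒x-y≈0 {x} {y} x≈y = ≈-trans (+-congˡ (-1*x≈-x y)) (x≈y⇒x∙y⁻¹≈ε x≈y)

  infix 4 _≋_
  _≋_ : Vector Carrier m → Vector Carrier m → Set ℓ
  u ≋ v = ∀ j → u j ≈ v j

  -- The standard bilinear form; h · v is also read as the value at v of the linear
  -- functional with coefficients h.
  infixl 7 _·_
  _·_ : Vector Carrier m → Vector Carrier m → Carrier
  u · v = sum (λ j → u j * v j)

  -- u +[ k ] v is the vector u + k v.
  infixl 6 _+[_]_
  _+[_]_ : Vector Carrier m → Carrier → Vector Carrier m → Vector Carrier m
  (u +[ k ] v) j = u j ⊕ k * v j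

  ·-cong : {u u′ v v′ : Vector Carrier m} → u ≋ u′ → v ≋ v′ → u · v ≈ u′ · v′
  ·-cong u≋u′ v≋v′ = sum-cong-≋ (λ j → *-cong (u≋u′ j) (v≋v′ j))

  ·-linearˡ : ∀ (u : Vector Carrier m) k v w → (u +[ k ] v) · w ≈ u · w ⊕ k * (v · w)
  ·-linearˡ u k v w = begin
    sum (λ j → (u j ⊕ k * v j) * w j)
      ≈⟨ sum-cong-≋ (λ j → ≈-trans (distribʳ (w j) (u j) (k * v j)) (+-congˡ (*-assoc k (v j) (w j)))) ⟩
    sum (λ j → u j * w j ⊕ k * (v j * w j))
      ≈⟨ ∑-distrib-+ (λ j → u j * w j) (λ j → k * (v j * w j)) ⟩
    u · w ⊕ sum (λ j → k * (v j * w j))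
      ≈⟨ +-congˡ (*-distribˡ-sum k (λ j → v j * w j)) ⟨
    u · w ⊕ k * (v · w) ∎

  ·-vanishing : ∀ {u : Vector Carrier m} v → (∀ j → u j ≈ 0#) → v · u ≈ 0#
  ·-vanishing {m} {u} v u≈0 = begin
    v · u                ≈⟨ sum-cong-≋ (λ j → ≈-trans (*-congˡ (u≈0 j)) (zeroʳ _)) ⟩
    sum (replicate m 0#) ≈⟨ sum-replicate-zero m ⟩
    0#                   ∎

  -- The standard basis vectors.
  δ : Fin m → Vector Carrier m
  δ zero    = 1# ∷ᶠ const 0#
  δ (suc i) = 0# ∷ᶠ δ i

  ·-δ : ∀ (v : Vector Carrier m) i → v · δ i ≈ v i
  ·-δ v zero = begin
    v zero * 1# ⊕ (v ∘ suc) · const 0#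
      ≈⟨ +-cong (*-identityʳ _) (·-vanishing (v ∘ suc) (λ _ → ≈-refl)) ⟩
    v zero ⊕ 0# ≈⟨ +-identityʳ _ ⟩
    v zero      ∎
  ·-δ v (suc i) = begin
    v zero * 0# ⊕ (v ∘ suc) · δ i ≈⟨ +-cong (zeroʳ _) (·-δ (v ∘ suc) i) ⟩
    0# ⊕ v (suc i)                ≈⟨ +-identityˡ _ ⟩
    v (suc i)                     ∎

  -- A matrix is a family of k row vectors of length m.
  Matrix : ℕ → ℕ → Set c
  Matrix k m = Fin k → Vector Carrier m

  _ᵀ : ∀ {k} → Matrix k m → Matrix m k
  (X ᵀ) j i = X i j

  -- a ⟪ X ⟫ is the combination of the rows of X with coefficients a. For a
  -- functional h, the vector h ⟪ X ᵀ ⟫ lists the values of h at the rows of X.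
  _⟪_⟫ : ∀ {k} → Vector Carrier k → Matrix k m → Vector Carrier m
  (a ⟪ X ⟫) j = a · (X ᵀ) j

  -- Independence of the rows. For rows that are coordinate vectors of points this
  -- unfolds to independence of the points.
  LinearlyIndependent : ∀ {k} → Matrix k m → Set _
  LinearlyIndependent X = ∀ a → (∀ j → (a ⟪ X ⟫) j ≈ 0#) → ∀ i → a i ≈ 0#

  ·-⟪⟫ : ∀ {k} (h : Vector Carrier m) a (X : Matrix k m) → h · (a ⟪ X ⟫) ≈ a · (h ⟪ X ᵀ ⟫)
  ·-⟪⟫ h a X = begin
    sum (λ j → h j * sum (λ i → a i * X i j))
      ≈⟨ sum-cong-≋ (λ j → *-distribˡ-sum (h j) (λ i → a i * X i j)) ⟩
    sum (λ j → sum (λ i → h j * (a i * X i j)))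
      ≈⟨ ∑-comm (λ j i → h j * (a i * X i j)) ⟩
    sum (λ i → sum (λ j → h j * (a i * X i j)))
      ≈⟨ sum-cong-≋ (λ i → sum-cong-≋ (λ j → exchange (h j) (a i) (X i j))) ⟩
    sum (λ i → sum (λ j → a i * (h j * X i j)))
      ≈⟨ sum-cong-≋ (λ i → *-distribˡ-sum (a i) (λ j → h j * X i j)) ⟨
    sum (λ i → a i * sum (λ j → h j * X i j)) ∎
    where
    exchange : ∀ x y z → x * (y * z) ≈ y * (x * z)
    exchange x y z = begin
      x * (y * z) ≈⟨ *-assoc _ _ _ ⟨
      x * y * z   ≈⟨ *-congʳ (*-comm x y) ⟩
      y * x * z   ≈⟨ *-assoc _ _ _ ⟩
      y * (x * z) ∎

  annihilates-span : ∀ {k} (h : Vector Carrier m) a (X : Matrix k m) →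
                     (∀ i → h · X i ≈ 0#) → h · (a ⟪ X ⟫) ≈ 0#
  annihilates-span h a X hX≈0 = ≈-trans (·-⟪⟫ h a X) (·-vanishing a hX≈0)

  -- Vectors of length m are coded by the numbers below q ^ m.
  decode : Fin (q ^ m) → Vector Carrier m
  decode {m} f = 𝕗.from ∘ finToFun {q} {m} f

  encode : Vector Carrier m → Fin (q ^ m)
  encode v = funToFin (𝕗.to ∘ v)

  funToFin-cong : ∀ {k} {f g : Fin m → Fin k} → (∀ i → f i ≡ g i) → funToFin f ≡ funToFin g
  funToFin-cong {zero}  eq = refl
  funToFin-cong {suc m} eq = ≡.cong₂ Fin.combine (eq zero) (funToFin-cong (eq ∘ suc))

  encode-cong : {u v : Vector Carrier m} → u ≋ v → encode u ≡ encode v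
  encode-cong u≋v = funToFin-cong (λ i → 𝕗.to-cong (u≋v i))

  decode-encode : ∀ (v : Vector Carrier m) → decode (encode v) ≋ v
  decode-encode v i =
    ≈-trans (𝕗.from-cong (finToFun-funToFin (𝕗.to ∘ v) i)) (𝕗.strictlyInverseʳ (v i))

  encode-decode : ∀ m (f : Fin (q ^ m)) → encode (decode {m} f) ≡ f
  encode-decode m f = ≡.trans
    (funToFin-cong (λ i → 𝕗.strictlyInverseˡ (finToFun {q} {m} f i)))
    (funToFin-finToFin {m} f)

  -- Independence makes the endomorphism φ below, which sends a to a ⟪ X ⟫ in coded
  -- form, injective on a finite set, hence surjective.
  independent⇒spanning : (X : Matrix m m) → LinearlyIndependent X →
                         ∀ b → ∃[ a ] (a ⟪ X ⟫ ≋ b)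
  independent⇒spanning {m} X ind b = decode f , λ j → begin
    (decode f ⟪ X ⟫) j         ≈⟨ decode-encode (decode f ⟪ X ⟫) j ⟨
    decode (φ f) j             ≡⟨ ≡.cong (λ g → decode g j) φf≡b ⟩
    decode (encode b) j        ≈⟨ decode-encode b j ⟩
    b j                        ∎
    where
    φ : Fin (q ^ m) → Fin (q ^ m)
    φ f = encode (decode f ⟪ X ⟫)

    φ-injective : Injective _≡_ _≡_ φ
    φ-injective {f} {g} φf≡φg = ≡.trans (≡.sym (encode-decode m f))
      (≡.trans (encode-cong (λ i → x-y≈0⇒x≈y (ind (decode f +[ ⊖ 1# ] decode g) vanish i)))
               (encode-decode m g))
      where
      equal : ∀ j → (decode f ⟪ X ⟫) j ≈ (decode g ⟪ X ⟫) j
      equal j = begin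
        (decode f ⟪ X ⟫) j ≈⟨ decode-encode (decode f ⟪ X ⟫) j ⟨
        decode (φ f) j     ≡⟨ ≡.cong (λ h → decode h j) φf≡φg ⟩
        decode (φ g) j     ≈⟨ decode-encode (decode g ⟪ X ⟫) j ⟩
        (decode g ⟪ X ⟫) j ∎

      vanish : ∀ j → ((decode f +[ ⊖ 1# ] decode g) ⟪ X ⟫) j ≈ 0#
      vanish j = ≈-trans
        (·-linearˡ (decode f) (⊖ 1#) (decode g) ((X ᵀ) j)) (x≈y⇒x-y≈0 (equal j))

    f : Fin (q ^ m)
    f = proj₁ (injective⇒surjective φ φ-injective (encode b))

    φf≡b : φ f ≡ encode b
    φf≡b = proj₂ (injective⇒surjective φ φ-injective (encode b))

  annihilates-all : (X : Matrix m m) → LinearlyIndependent X →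
                    ∀ h → (∀ i → h · X i ≈ 0#) → ∀ v → h · v ≈ 0#
  annihilates-all X ind h hX≈0 v = begin
    h · v          ≈⟨ ·-cong {u = h} (λ _ → ≈-refl) (proj₂ (independent⇒spanning X ind v)) ⟨
    h · (a ⟪ X ⟫)  ≈⟨ annihilates-span h a X hX≈0 ⟩
    0#             ∎
    where a = proj₁ (independent⇒spanning X ind v)

  -- A functional that vanishes on the rows of X vanishes on each standard basis
  -- vector, so its coefficients are zero.
  independentᵀ : (X : Matrix m m) → LinearlyIndependent X → LinearlyIndependent (X ᵀ)
  independentᵀ X ind h hX≈0 i =
    ≈-trans (≈-sym (·-δ h i)) (annihilates-all X ind h hX≈0 (δ i))

  interpolating-functional : (X : Matrix m m) → LinearlyIndependent X →
                             ∀ b → ∃[ w ] (∀ i → w · X i ≈ b i)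
  interpolating-functional X ind = independent⇒spanning (X ᵀ) (independentᵀ X ind)

  -- Translation of all functionals by the multiples of a fixed w

  module _ (w : Vector Carrier m) where

    -- The coded form of f ↦ f + k w.
    translate : Carrier → Fin (q ^ m) → Fin (q ^ m)
    translate k f = encode (decode f +[ k ] w)

    decode-translate : ∀ k f v → decode (translate k f) · v ≈ decode f · v ⊕ k * (w · v)
    decode-translate k f v = ≈-trans
      (·-cong {v = v} (decode-encode (decode f +[ k ] w)) (λ _ → ≈-refl))
      (·-linearˡ (decode f) k w v)

    translate-inverse : ∀ {k k′} → k ⊕ k′ ≈ 0# → ∀ f → translate k′ (translate k f) ≡ f
    translate-inverse {k} {k′} k+k′≈0 f =
      ≡.trans (encode-cong λ j → begin
        decode (translate k f) j ⊕ k′ * w j   ≈⟨ +-congʳ (decode-encode (decode f +[ k ] w) j) ⟩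
        (decode f j ⊕ k * w j) ⊕ k′ * w j     ≈⟨ +-assoc _ _ _ ⟩
        decode f j ⊕ (k * w j ⊕ k′ * w j)     ≈⟨ +-congˡ (distribʳ _ _ _) ⟨
        decode f j ⊕ (k ⊕ k′) * w j           ≈⟨ +-congˡ (≈-trans (*-congʳ k+k′≈0) (zeroˡ _)) ⟩
        decode f j ⊕ 0#                       ≈⟨ +-identityʳ _ ⟩
        decode f j                            ∎)
      (encode-decode m f)

    translation : Carrier → Permutation′ (q ^ m)
    translation k = permutation (translate k) (translate (⊖ k))
      (translate-inverse (-‿inverseˡ k)) (translate-inverse (-‿inverseʳ k))

  -- Linear secret sharing schemes

  module _ (d : Vector Carrier m) (x : Fin n → Vector Carrier m) where

    -- Every functional that vanishes on the vectors of B vanishes on d; that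
    -- is, d lies in their span.
    Determines : Subset n → Set _
    Determines B = ∀ h → (∀ P → P ∈ B → h · x P ≈ 0#) → h · d ≈ 0#

    -- Some functional vanishes on the vectors of B but not on d, normalised to
    -- take the value 1 there; that is, d lies outside their span.
    Separates : Subset n → Set _
    Separates B = ∃[ w ] (w · d ≈ 1# × ∀ P → P ∈ B → w · x P ≈ 0#)

    -- The vector space construction: the rows are all functionals f on the
    -- space of m coordinates, the key in row f is f · d and the share of the
    -- participant P is f · x P.
    module _ (Γ : AccessStructure n)
             (determines : ∀ B → AccessStructure.Authorized Γ B → Determines B)
             (separates  : ∀ B → ¬ AccessStructure.Authorized Γ B → Separates B) where

      private
        keyOf : Fin (q ^ m) → Fin q
        keyOf f = 𝕗.to (decode f · d)

        shareOf : Fin (q ^ m) → Fin n → Fin q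
        shareOf f P = 𝕗.to (decode f · x P)

        -- Row g has key K and agrees with row f on B.
        Consistent : Subset n → Fin (q ^ m) → Fin q → Fin (q ^ m) → Set
        Consistent B f K g = keyOf g ≡ K × (∀ P → P ∈ B → shareOf g P ≡ shareOf f P)

        consistent-translate :
          ∀ {B} ((w , _) : Separates B) {k K K′} → 𝕗.from K ⊕ k ≈ 𝕗.from K′ →
          ∀ {f g} → Consistent B f K g → Consistent B f K′ (translate w k g)
        consistent-translate {B} (w , wd≈1 , wx≈0) {k} {K} {K′} K+k≈K′ {f} {g} (refl , agree) =
          𝕗.inverseˡ newKey , λ P P∈B → ≡.trans (𝕗.to-cong (sameShare P P∈B)) (agree P P∈B)
          where
          newKey : decode (translate w k g) · d ≈ 𝕗.from K′
          newKey = begin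
            decode (translate w k g) · d   ≈⟨ decode-translate w k g d ⟩
            decode g · d ⊕ k * (w · d)     ≈⟨ +-congˡ (≈-trans (*-congˡ wd≈1) (*-identityʳ k)) ⟩
            decode g · d ⊕ k               ≈⟨ +-congʳ (𝕗.strictlyInverseʳ _) ⟨
            𝕗.from K ⊕ k                   ≈⟨ K+k≈K′ ⟩
            𝕗.from K′                      ∎

          sameShare : ∀ P → P ∈ B → decode (translate w k g) · x P ≈ decode g · x P
          sameShare P P∈B = begin
            decode (translate w k g) · x P   ≈⟨ decode-translate w k g (x P) ⟩
            decode g · x P ⊕ k * (w · x P)   ≈⟨ +-congˡ (≈-trans (*-congˡ (wx≈0 P P∈B)) (zeroʳ k)) ⟩
            decode g · x P ⊕ 0#              ≈⟨ +-identityʳ _ ⟩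
            decode g · x P                   ∎

        -- Translation by the multiple K′ - K of w, with inverse translation by the
        -- opposite multiple, matches the rows counted for K with those counted for K′.
        consistent-translation :
          ∀ {B} ((w , _) : Separates B) f K K′ → let k = 𝕗.from K′ ⊕ ⊖ 𝕗.from K in
          ∀ g → Consistent B f K g ⇔ Consistent B f K′ (translate w k g)
        consistent-translation {B} sep@(w , _) f K K′ g = mk⇔
          (consistent-translate sep forth)
          (≡.subst (Consistent B f K) (translate-inverse w (-‿inverseʳ k) g)
            ∘ consistent-translate sep back)
          where
          k = 𝕗.from K′ ⊕ ⊖ 𝕗.from K

          forth : 𝕗.from K ⊕ k ≈ 𝕗.from K′
          forth = ≈-trans (≈-sym (+-assoc _ _ _)) (xyx⁻¹≈y _ _)

          back : 𝕗.from K′ ⊕ ⊖ k ≈ 𝕗.from K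
          back = begin
            𝕗.from K′ ⊕ ⊖ k         ≈⟨ +-congʳ forth ⟨
            𝕗.from K ⊕ k ⊕ ⊖ k      ≈⟨ +-assoc _ _ _ ⟩
            𝕗.from K ⊕ (k ⊕ ⊖ k)    ≈⟨ +-congˡ (-‿inverseʳ k) ⟩
            𝕗.from K ⊕ 0#           ≈⟨ +-identityʳ _ ⟩
            𝕗.from K                ∎

        shares-determine-key : ∀ {B} → Determines B → ∀ f g →
                               (∀ P → P ∈ B → shareOf f P ≡ shareOf g P) → keyOf f ≡ keyOf g
        shares-determine-key det f g agree = 𝕗.to-cong (x-y≈0⇒x≈y (≈-trans
          (≈-sym (·-linearˡ (decode f) (⊖ 1#) (decode g) d))
          (det _ λ P P∈B → ≈-trans
            (·-linearˡ (decode f) (⊖ 1#) (decode g) (x P))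
            (x≈y⇒x-y≈0 (to-injective (agree P P∈B))))))

      linearScheme : PerfectScheme Γ
      linearScheme = record
        { #keys = q ; #shares = q ; #rows = q ^ m
        ; rows-nonempty = ℕₚ.m^n≢0 q m {{>-nonZero (ℕₚ.≤-trans (s≤s z≤n) 2≤q)}}
        ; key     = keyOf
        ; share   = shareOf
        ; correct = λ B auth → shares-determine-key (determines B auth)
        ; perfect = λ B unauth f K K′ → let sep = separates B unauth in
            count-permute _ _ (translation (proj₁ sep) _) (consistent-translation sep f K K′)
        }

      linearScheme-ideal : IsIdeal linearScheme
      linearScheme-ideal = refl , 2≤q

  -- The scheme of a harc

  open Projective 𝔽
    using (Point; vec; Subspace; Hyperplane; Independent; combination; _∈ˢ_)

  -- The matrix whose rows are the coordinate vectors of the given points.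
  coordinates : ∀ {r k} → (Fin k → Point r) → Matrix k (suc r)
  coordinates y i = vec (y i)

  -- In a dependency the coefficient of p must vanish, as p could otherwise be
  -- solved for and would lie in Ψ; the basis of Ψ is independent.
  hyperplane-and-point : ∀ {r} (Ψ : Hyperplane r) {p : Point r} → ¬ (p ∈ˢ Ψ) →
                         Independent (p ∷ᶠ Subspace.basis Ψ)
  hyperplane-and-point Ψ {p} p∉Ψ a comb≈0 = λ { zero → a₀≈0 ; (suc i) → aₛ≈0 i }
    where
    b = Subspace.basis Ψ

    a₀≈0 : a zero ≈ 0#
    a₀≈0 with a zero ≈? 0#
    ... | yes a₀≈0 = a₀≈0
    ... | no  a₀≉0 with y , a₀y≈1 ← inverse (a zero) a₀≉0 =
      contradiction ((λ i → ⊖ y * a (suc i)) , inΨ) p∉Ψ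
      where
      inΨ : ∀ j → vec p j ≈ combination (λ i → ⊖ y * a (suc i)) b j
      inΨ j = begin
        vec p j                  ≈⟨ *-identityˡ _ ⟨
        1# * vec p j             ≈⟨ *-congʳ (≈-trans (*-comm y (a zero)) a₀y≈1) ⟨
        y * a zero * vec p j     ≈⟨ *-assoc _ _ _ ⟩
        y * (a zero * vec p j)   ≈⟨ *-congˡ (+-inverseˡ-unique _ _ (comb≈0 j)) ⟩
        y * ⊖ S                  ≈⟨ -‿distribʳ-* y S ⟨
        ⊖ (y * S)                ≈⟨ -‿distribˡ-* y S ⟩
        ⊖ y * S                  ≈⟨ *-distribˡ-sum (⊖ y) (λ i → a (suc i) * vec (b i) j) ⟩
        sum (λ i → ⊖ y * (a (suc i) * vec (b i) j))
          ≈⟨ sum-cong-≋ (λ i → *-assoc (⊖ y) (a (suc i)) (vec (b i) j)) ⟨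
        combination (λ i → ⊖ y * a (suc i)) b j ∎
        where S = combination (a ∘ suc) b j

    aₛ≈0 : ∀ i → a (suc i) ≈ 0#
    aₛ≈0 = Subspace.independent Ψ (a ∘ suc) λ j → begin
      combination (a ∘ suc) b j                       ≈⟨ +-identityˡ _ ⟨
      0# ⊕ combination (a ∘ suc) b j
        ≈⟨ +-congʳ (≈-trans (*-congʳ a₀≈0) (zeroˡ (vec p j))) ⟨
      a zero * vec p j ⊕ combination (a ∘ suc) b j    ≈⟨ comb≈0 j ⟩
      0#                                              ∎

  -- The point x zero belongs to the dealer and x (suc P) to the participant P.
  module _ {r n} (Ψ : Hyperplane r) (x : Fin (suc n) → Point r) (U : Subset n)
           (dealer∉Ψ : ¬ (x zero ∈ˢ Ψ))
           (upper∉Ψ : ∀ {P} → P ∈ U → ¬ (x (suc P) ∈ˢ Ψ))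
           (lower∈Ψ : ∀ {P} → P ∈ ∁ U → x (suc P) ∈ˢ Ψ)
           (mixed : ∀ (e : Fin (suc r) → Fin (suc n)) → Injective _≡_ _≡_ e →
                    ¬ (∀ i → x (e i) ∈ˢ Ψ) → Independent (x ∘ e))
           where

    private
      Γ : AccessStructure n
      Γ = hierarchical (suc r) U

      d : Vector Carrier (suc r)
      d = vec (x zero)

      s : Matrix n (suc r)
      s = coordinates (x ∘ suc)

    open AccessStructure Γ

    authorized⇒determines : ∀ B → Authorized B → Determines d s B
    authorized⇒determines B (t≤∣B∣ , u , u∈) h hB≈0
      with u∈B , u∈U ← x∈p∩q⁻ B U u∈
      with S , u∈S , S⊆B , ∣S∣≡t ← authorized⊇basic (suc r) (s≤s z≤n) t≤∣B∣ u∈B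
      = annihilates-all (coordinates (x ∘ suc ∘ element))
          (mixed (suc ∘ element) (injective ∘ suc-injective) outside-Ψ)
          h (λ i → hB≈0 (element i) (S⊆B (sound i))) d
      where
      open Enumeration (enumerateAs S ∣S∣≡t)

      outside-Ψ : ¬ (∀ i → x (suc (element i)) ∈ˢ Ψ)
      outside-Ψ all∈Ψ with i , refl ← complete u∈S = upper∉Ψ u∈U (all∈Ψ i)

    -- B is enlarged to exactly r participants, so that with the dealer there are
    -- r + 1 points, to which the hypothesis on mixed families applies.
    small⇒separates : r ≤ n → ∀ B → ∣ B ∣ ≤ r → Separates d s B
    small⇒separates r≤n B ∣B∣≤r
      with S , B⊆S , _ , ∣S∣≡r ←
        subset-between {C = ⊤} (⊆-max B) ∣B∣≤r (≡.subst (r ≤_) (≡.sym (∣⊤∣≡n n)) r≤n)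
      = w , wX≈δ zero , λ P P∈B → vanishes P (complete (B⊆S P∈B))
      where
      open Enumeration (enumerateAs S ∣S∣≡r)

      e : Fin (suc r) → Fin (suc n)
      e = zero ∷ᶠ (suc ∘ element)

      e-injective : Injective _≡_ _≡_ e
      e-injective {zero}  {zero}  _  = refl
      e-injective {suc i} {suc j} eq = ≡.cong suc (injective (suc-injective eq))

      solution : ∃[ w ] (∀ i → w · vec (x (e i)) ≈ (1# ∷ᶠ const 0#) i)
      solution = interpolating-functional (coordinates (x ∘ e))
        (mixed e e-injective (λ all∈Ψ → dealer∉Ψ (all∈Ψ zero))) _

      w    = proj₁ solution
      wX≈δ = proj₂ solution

      vanishes : ∀ P → ∃[ i ] element i ≡ P → w · s P ≈ 0#
      vanishes P (i , refl) = wX≈δ (suc i)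

    lower⇒separates : ∀ B → B ⊆ ∁ U → Separates d s B
    lower⇒separates B B⊆L = w , wX≈δ zero , λ P P∈B → vanishes P (lower∈Ψ (B⊆L P∈B))
      where
      solution : ∃[ w ] (∀ i → w · vec ((x zero ∷ᶠ Subspace.basis Ψ) i) ≈ (1# ∷ᶠ const 0#) i)
      solution = interpolating-functional (coordinates (x zero ∷ᶠ Subspace.basis Ψ))
        (hyperplane-and-point Ψ {x zero} dealer∉Ψ) _

      w    = proj₁ solution
      wX≈δ = proj₂ solution

      vanishes : ∀ P → x (suc P) ∈ˢ Ψ → w · s P ≈ 0#
      vanishes P (a , eq) = ≈-trans (·-cong {u = w} (λ _ → ≈-refl) eq)
        (annihilates-span w a (coordinates (Subspace.basis Ψ)) (wX≈δ ∘ suc))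

    unauthorized⇒separates : r ≤ n → ∀ B → ¬ Authorized B → Separates d s B
    unauthorized⇒separates r≤n B unauth with suc r ≤? ∣ B ∣
    ... | yes t≤∣B∣ = lower⇒separates B (disjoint⇒⊆∁ λ B∩U≢∅ → unauth (t≤∣B∣ , B∩U≢∅))
    ... | no  t≰∣B∣ = small⇒separates r≤n B (s≤s⁻¹ (ℕₚ.≰⇒> t≰∣B∣))

    idealScheme : Σ[ S ∈ PerfectScheme Γ ] IsIdeal S
    idealScheme with r ≤? n
    ... | yes r≤n = linearScheme d s Γ det sep , linearScheme-ideal d s Γ det sep
      where
      det = authorized⇒determines
      sep = unauthorized⇒separates r≤n
    -- With fewer than r participants nothing is authorized. The key is a single
    -- coordinate and all shares are zero.
    ... | no  r≰n = linearScheme d₀ s₀ Γ det sep , linearScheme-ideal d₀ s₀ Γ det sep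
      where
      d₀ : Vector Carrier 1
      d₀ = const 1#

      s₀ : Matrix n 1
      s₀ _ = const 0#

      det : ∀ B → Authorized B → Determines d₀ s₀ B
      det B (r<∣B∣ , _) = contradiction (ℕₚ.≤-trans (ℕₚ.<⇒≤ r<∣B∣) (∣p∣≤n B)) r≰n

      sep : ∀ B → ¬ Authorized B → Separates d₀ s₀ B
      sep B _ = d₀ , ≈-trans (+-identityʳ _) (*-identityʳ 1#) , λ P _ → ·-vanishing d₀ (λ _ → ≈-refl)

-- The first k of k + l elements, that is, those participants whose points come
-- from the first of two concatenated families.
upper : ∀ k {l} → Subset (k + l)
upper k = tabulate ([ const inside , const outside ] ∘ splitAt k)

theorem4p2 : ∀ {c ℓ} (q t k₁ k₂ : ℕ) → PrimePower q → 2 ≤ t → 2 ≤ k₁ → 0 ≤ k₂ →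
    (GF : GaloisField q c ℓ) →
    Harc GF (t ∸ 1) k₁ k₂ →
    IdealHierarchicalScheme (k₁ + k₂ ∸ 1) t
-- The dealer receives the point of K₁ with index 0, so the participants are
-- indexed by the k + 1 remaining points of K₁ followed by the points of K₂.
theorem4p2 q (suc r) (suc (suc k)) k₂ _ _ (s≤s (s≤s _)) _ GF H =
  hierarchical (suc r) U
  , isHierarchical (suc r) U (s≤s z≤n) (zero , here)
  , idealScheme GF Ψ x U (K₁-outside zero) upper∉Ψ lower∈Ψ mixed
  where
  open Harc H
  open Projective GF using (_∈ˢ_; Point)

  U : Subset (suc k + k₂)
  U = upper (suc k)

  x : Fin (suc (suc k) + k₂) → Point r
  x = K₁ ++ᶠ K₂

  U-lookup : ∀ P → _
  U-lookup P = lookup∘tabulate ([ const inside , const outside ] ∘ splitAt (suc k)) P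

  upper∉Ψ : ∀ {P} → P ∈ U → ¬ (x (suc P) ∈ˢ Ψ)
  upper∉Ψ {P} P∈U with splitAt (suc k) P | ≡.trans (≡.sym (U-lookup P)) ([]=⇒lookup P∈U)
  ... | inj₁ i | _ = K₁-outside (suc i)
  ... | inj₂ _ | ()

  lower∈Ψ : ∀ {P} → P ∈ ∁ U → x (suc P) ∈ˢ Ψ
  lower∈Ψ {P} P∈L with splitAt (suc k) P | U-lookup P
  ... | inj₁ _ | P∈U = contradiction (lookup⇒[]= P U P∈U) (x∈∁p⇒x∉p P∈L)
  ... | inj₂ j | _   = proj₁ K₂-arc j
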